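{- Let $M$ be a positive integer. Suppose $x>2$, $y>0$, and $c$ are integers such that $3^y\equiv c+2^x \bmod M$. If $O_3'(M)$ is not divisible by $2^{x-1}$ and $O_2'(M)$ is not divisible by $3^{y}$, then there are integers $x'\ge 0$ and $y'\ge 0$ such that (a) $3^{y'}\equiv c+2^{x'}\bmod M$, (b) $2^{x'}$ is an indeterminate power of $2$ modulo $M$, and (c) $3^{y'}$ is an indeterminate power of $3$ modulo $M$.
   Context: For a positive integer $M$, write $M=2^u3^vM'$ with $u,v\ge 0$ integers and $M'$ a positive integer coprime to $6$. Then $O_2'(M)$ denotes the multiplicative order of $2$ in the ring $\mathbf{Z}/M'\mathbf{Z}$, and $O_3'(M)$ denotes the multiplicative order of $3$ in the ring $\mathbf{Z}/M'\mathbf{Z}$ (both are $1$ if $M'=1$). For an integer $M>0$, a prime $p$ and an integer $i\ge 0$, the power $p^i$ is called determinate modulo $M$ if the only integer $b\ge 0$ with $p^b\equiv p^i\bmod M$ is $b=i$; otherwise $p^i$ is called an indeterminate power of $p$ modulo $M$. -}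

module Defs where

open import Data.Nat using (ℕ; zero; suc; _+_; _*_; _∸_; _^_; _%_; _/_; _≤_; _<_; NonZero)
open import Data.Nat.Properties
open import Data.Nat.Coprimality using (Coprime; coprime-divisor)
open import Data.Nat.Divisibility using (_∣_; divides; _∣?_; quotient-<; quotient≢0; ∣-trans; ∣n⇒∣m*n; m∣n⇒n≡m*quotient)
open import Data.Nat.DivMod using (m≡m%n+[m/n]*n; m%n<n)
open import Data.Nat.Primality using (Prime; prime?; prime⇒nonTrivial; prime⇒irreducible)
open import Data.Nat.Induction using (<-rec)
open import Data.Integer as ℤ using (ℤ; +_)
import Data.Integer.Divisibility.Signed as ℤ
open import Data.Fin using (toℕ; fromℕ<)
open import Data.Fin.Properties using (pigeonhole; toℕ-fromℕ<)
open import Data.Product using (∃; _×_; _,_; proj₁; proj₂)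
open import Data.Sum using (inj₁; inj₂)
open import Relation.Nullary using (¬_; yes; no; contradiction)
open import Relation.Nullary.Decidable using (toWitness; _×-dec_)
open import Relation.Unary using (Decidable)
open import Relation.Binary.PropositionalEquality

infix 4 _≡_[mod_]

_≡_[mod_] : ℤ → ℤ → ℕ → Set
a ≡ b [mod m ] = + m ℤ.∣ a ℤ.- b

-- A property of the exponent i relative to the base p; used for p prime.
Determinate : (p i M : ℕ) → Set
Determinate p i M = ∀ b → + (p ^ b) ≡ + (p ^ i) [mod M ] → b ≡ i

Indeterminate : (p i M : ℕ) → Set
Indeterminate p i M = ¬ Determinate p i M

-- k is the multiplicative order of a in ℤ/mℤ; for m = 1 this forces k ≡ 1.
record IsOrder (a m k : ℕ) : Set where
  field
    positive : 0 < k
    power≡1  : + (a ^ k) ≡ + 1 [mod m ]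
    minimal  : ∀ j → 0 < j → + (a ^ j) ≡ + 1 [mod m ] → k ≤ j

private
  least : {P : ℕ → Set} → Decidable P → ∀ n → P n →
          ∃ λ k → P k × (∀ j → P j → k ≤ j)
  least {P} P? = <-rec _ step
    where
    step : ∀ n → (∀ {m} → m < n → P m → ∃ λ k → P k × (∀ j → P j → k ≤ j)) →
           P n → ∃ λ k → P k × (∀ j → P j → k ≤ j)
    step n rec Pn with anyUpTo? P? n
    ... | yes (m , m<n , Pm) = rec m<n Pm
    ... | no  none           = n , Pn , λ j Pj → ≮⇒≥ (λ j<n → none (j , j<n , Pj))

  coprime-cancel-^ : ∀ {m a} → Coprime m a → ∀ i {o} → m ∣ a ^ i * o → m ∣ o
  coprime-cancel-^ c zero    {o} d = subst (_ ∣_) (+-identityʳ o) d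
  coprime-cancel-^ {m} {a} c (suc i) {o} d =
    coprime-cancel-^ c i (coprime-divisor c (subst (m ∣_) (*-assoc a (a ^ i) o) d))

  %≡⇒∣∸ : ∀ m n d .{{_ : NonZero d}} → m % d ≡ n % d → d ∣ m ∸ n
  %≡⇒∣∸ m n d eq = divides (m / d ∸ n / d) (begin
    m ∸ n                                       ≡⟨ cong₂ _∸_ (m≡m%n+[m/n]*n m d) (m≡m%n+[m/n]*n n d) ⟩
    (m % d + m / d * d) ∸ (n % d + n / d * d)   ≡⟨ cong (λ r → (r + m / d * d) ∸ (n % d + n / d * d)) eq ⟩
    (n % d + m / d * d) ∸ (n % d + n / d * d)   ≡⟨ [m+n]∸[m+o]≡n∸o (n % d) _ _ ⟩
    m / d * d ∸ n / d * d                       ≡⟨ *-distribʳ-∸ d (m / d) (n / d) ⟨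
    (m / d ∸ n / d) * d                         ∎)
    where open ≡-Reasoning

  ^∸^ : ∀ a {i j} → i ≤ j → a ^ j ∸ a ^ i ≡ a ^ i * (a ^ (j ∸ i) ∸ 1)
  ^∸^ a {i} {j} i≤j = begin
    a ^ j ∸ a ^ i                     ≡⟨ cong (λ k → a ^ k ∸ a ^ i) (m+[n∸m]≡n i≤j) ⟨
    a ^ (i + (j ∸ i)) ∸ a ^ i         ≡⟨ cong₂ _∸_ (^-distribˡ-+-* a i (j ∸ i)) (sym (*-identityʳ (a ^ i))) ⟩
    a ^ i * a ^ (j ∸ i) ∸ a ^ i * 1   ≡⟨ *-distribˡ-∸ (a ^ i) _ 1 ⟨
    a ^ i * (a ^ (j ∸ i) ∸ 1)         ∎
    where open ≡-Reasoning

  ∣∸1⇒≡1 : ∀ m n .{{_ : NonZero n}} → m ∣ n ∸ 1 → + n ≡ + 1 [mod m ]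
  ∣∸1⇒≡1 m (suc n) d = ℤ.∣ᵤ⇒∣ d

  somePower≡1 : ∀ a m .{{_ : NonZero a}} .{{_ : NonZero m}} → Coprime m a →
                ∃ λ k → 0 < k × + (a ^ k) ≡ + 1 [mod m ]
  somePower≡1 a m c
    with pigeonhole {m} {suc m} ≤-refl (λ i → fromℕ< (m%n<n (a ^ toℕ i) m))
  ... | i , j , i<j , eq =
    k , m<n⇒0<n∸m i<j , ∣∸1⇒≡1 m (a ^ k) {{m^n≢0 a k}} m∣aᵏ∸1
    where
    k = toℕ j ∸ toℕ i

    eq% : a ^ toℕ j % m ≡ a ^ toℕ i % m
    eq% = trans (sym (toℕ-fromℕ< (m%n<n (a ^ toℕ j) m)))
         (trans (cong toℕ (sym eq)) (toℕ-fromℕ< (m%n<n (a ^ toℕ i) m)))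

    m∣aᵏ∸1 : m ∣ a ^ k ∸ 1
    m∣aᵏ∸1 = coprime-cancel-^ c (toℕ i)
      (subst (m ∣_) (^∸^ a (<⇒≤ i<j)) (%≡⇒∣∸ (a ^ toℕ j) (a ^ toℕ i) m eq%))

order-exists : ∀ a m .{{_ : NonZero a}} .{{_ : NonZero m}} → Coprime m a → ∃ (IsOrder a m)
order-exists a m c
  with k , 0<k , eq ← somePower≡1 a m c
  with l , (0<l , eq′) , min ←
    least (λ j → (0 <? j) ×-dec (+ m ℤ.∣? (+ (a ^ j) ℤ.- + 1))) k (0<k , eq)
  = l , record { positive = 0<l ; power≡1 = eq′ ; minimal = λ j 0<j e → min j (0<j , e) }

order-unique : ∀ {a m k l} → IsOrder a m k → IsOrder a m l → k ≡ l
order-unique p q = ≤-antisym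
  (minimal p _ (positive q) (power≡1 q)) (minimal q _ (positive p) (power≡1 p))
  where open IsOrder

order : ∀ a m .{{_ : NonZero a}} .{{_ : NonZero m}} → Coprime m a → ℕ
order a m c = proj₁ (order-exists a m c)

order-isOrder : ∀ a m .{{_ : NonZero a}} .{{_ : NonZero m}} (c : Coprime m a) →
                IsOrder a m (order a m c)
order-isOrder a m c = proj₂ (order-exists a m c)

-- u, v and M′ are uniquely determined by M, so the choice made by decompose
-- below is immaterial.
record Decomposition (M : ℕ) : Set where
  field
    u v M′     : ℕ
    M≡         : M ≡ 2 ^ u * 3 ^ v * M′
    M′≢0       : NonZero M′
    M′-coprime : Coprime M′ 6

  coprime-2 : Coprime M′ 2
  coprime-2 (d∣M′ , d∣2) = M′-coprime (d∣M′ , ∣-trans d∣2 (divides 3 refl))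

  coprime-3 : Coprime M′ 3
  coprime-3 (d∣M′ , d∣3) = M′-coprime (d∣M′ , ∣-trans d∣3 (divides 2 refl))

private
  PrimeFree : ℕ → ℕ → Set
  PrimeFree p M = ∃ λ k → ∃ λ q → M ≡ p ^ k * q × NonZero q × ¬ p ∣ q

  removePrime : ∀ {p} → Prime p → ∀ M → NonZero M → PrimeFree p M
  removePrime {p} pr = <-rec _ step
    where
    step : ∀ M → (∀ {N} → N < M → NonZero N → PrimeFree p N) → NonZero M → PrimeFree p M
    step M rec nz with p ∣? M
    ... | no  p∤M = 0 , M , sym (+-identityʳ M) , nz , p∤M
    ... | yes p∣M
      with k , q , N≡ , q≢0 , p∤q ←
        rec (quotient-< p∣M {{prime⇒nonTrivial pr}} {{nz}}) (quotient≢0 p∣M {{nz}})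
      = suc k , q
      , trans (m∣n⇒n≡m*quotient p∣M) (trans (cong (p *_) N≡) (sym (*-assoc p (p ^ k) q)))
      , q≢0 , p∤q

  ∤⇒coprime : ∀ {p n} → Prime p → ¬ p ∣ n → Coprime n p
  ∤⇒coprime pr p∤n (d∣n , d∣p) with prime⇒irreducible pr d∣p
  ... | inj₁ d≡1  = d≡1
  ... | inj₂ refl = contradiction d∣n p∤n

  coprime-6 : ∀ {n} → Coprime n 2 → Coprime n 3 → Coprime n 6
  coprime-6 {n} c₂ c₃ {d} (d∣n , d∣6) = c₃ (d∣n , coprime-divisor d-2 d∣6)
    where
    d-2 : Coprime d 2
    d-2 (e∣d , e∣2) = c₂ (∣-trans e∣d d∣n , e∣2)

  prime-2 : Prime 2
  prime-2 = toWitness {a? = prime? 2} _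

  prime-3 : Prime 3
  prime-3 = toWitness {a? = prime? 3} _

decompose : ∀ M .{{_ : NonZero M}} → Decomposition M
decompose M@(suc _)
  with u , N , M≡ , N≢0 , 2∤N ← removePrime prime-2 M _
  with v , q , N≡ , q≢0 , 3∤q ← removePrime prime-3 N N≢0
  = record
  { u = u ; v = v ; M′ = q
  ; M≡ = trans M≡ (trans (cong (2 ^ u *_) N≡) (sym (*-assoc (2 ^ u) (3 ^ v) q)))
  ; M′≢0 = q≢0
  ; M′-coprime = coprime-6 (∤⇒coprime prime-2 (λ 2∣q → 2∤N (subst (2 ∣_) (sym N≡) (∣n⇒∣m*n (3 ^ v) 2∣q))))
                           (∤⇒coprime prime-3 3∤q)
  }

O₂′ : ∀ M .{{_ : NonZero M}} → ℕ
O₂′ M = order 2 M′ {{_}} {{M′≢0}} coprime-2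
  where open Decomposition (decompose M)

O₃′ : ∀ M .{{_ : NonZero M}} → ℕ
O₃′ M = order 3 M′ {{_}} {{M′≢0}} coprime-3
  where open Decomposition (decompose M)

{-# OPTIONS --safe #-}

-- Write M = 2^u 3^v M′. The power 2^i is indeterminate modulo M as soon as u ≤ i, and 3^i as soon
-- as v ≤ i. So it suffices to find y′ ≥ v with 3^y′ ≡ 3^y mod M′ and 3^y′ ≡ 3^y − 2^x mod 2^u, and
-- x′ ≥ u with 2^x′ ≡ 2^x mod M′ and 2^x′ ≡ 2^x − 3^y mod 3^v: modulo 2^u the term 2^x′ vanishes,
-- modulo 3^v the term 3^y′ does. Both are instances of one Hensel-type lemma: the exponent is
-- corrected by multiples of the order O modulo M′, raising the p-adic precision one digit at a time.
-- A multiple d of O for which a^d − 1 has p-adic valuation exactly k exists for every k at least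
-- the exponent on p in the correction term, and this is what the non-divisibility hypotheses provide.

module Submission where

open import Defs
open import Data.Nat using (ℕ; _∸_; _^_; _<_; NonZero; zero; suc; _≤_; s≤s)
open import Data.Nat.Divisibility using (_∣_)
open import Data.Integer using (ℤ; +_; _+_)
open import Data.Product using (∃; ∃₂; _×_; _,_)
open import Relation.Nullary using (¬_; yes; no; contradiction)
import Data.Nat as ℕ
import Data.Nat.Divisibility as ℕ
import Data.Nat.Properties as ℕ
import Data.Nat.Tactic.RingSolver as ℕ
import Data.Nat.Coprimality as Coprimality
open import Data.Nat.Coprimality using (Coprime; coprime?; coprime-divisor; coprime-Bézout)
open import Data.Nat.GCD using (module Bézout)
open import Data.Nat.Primality using (Prime; prime?; prime⇒irreducible)
import Data.Integer as ℤ
import Data.Integer.Properties as ℤ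
import Data.Integer.Divisibility.Signed as ℤ
import Data.Integer.Tactic.RingSolver as ℤ
open import Data.Sum using (inj₁; inj₂)
open import Relation.Nullary.Decidable using (toWitness)
open import Relation.Binary.PropositionalEquality

-- Coprimality and linear congruences.

coprime-* : ∀ {m n p} → Coprime m p → Coprime n p → Coprime (m ℕ.* n) p
coprime-* {m} cm cn {d} (d∣mn , d∣p) = cn (coprime-divisor d⊥m d∣mn , d∣p)
  where
  d⊥m : Coprime d m
  d⊥m (e∣d , e∣m) = cm (e∣m , ℕ.∣-trans e∣d d∣p)

coprime-^ : ∀ {m p} → Coprime m p → ∀ n → Coprime (m ^ n) p
coprime-^ c zero    = Coprimality.1-coprimeTo _
coprime-^ c (suc n) = coprime-* c (coprime-^ c n)

coprime-+* : ∀ {s p} → Coprime s p → ∀ z → Coprime (s ℕ.+ p ℕ.* z) p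
coprime-+* {s} {p} c z {d} (d∣s+pz , d∣p) =
  c (ℕ.∣m+n∣m⇒∣n (subst (d ∣_) (ℕ.+-comm s (p ℕ.* z)) d∣s+pz) (ℕ.∣m⇒∣m*n z d∣p) , d∣p)

coprime-*-∣ : ∀ {m n k} → Coprime m n → m ∣ k → n ∣ k → m ℕ.* n ∣ k
coprime-*-∣ {m} {n} c m∣k (ℕ.divides q refl) =
  ℕ.*-monoˡ-∣ n (coprime-divisor c (subst (m ∣_) (ℕ.*-comm q n) m∣k))

-- In the case r i ≡ 1 the solution k = −i e is represented in ℕ by i * (e * p), as p ≡ −1.
solve-linear : ∀ {r p} e → Coprime r (suc p) → ∃ λ k → suc p ∣ e ℕ.+ r ℕ.* k
solve-linear {r} {p} e c with coprime-Bézout c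
... | Bézout.+- i j eq = i ℕ.* (e ℕ.* p) , ℕ.divides (e ℕ.+ j ℕ.* (e ℕ.* p)) (begin
  e ℕ.+ r ℕ.* (i ℕ.* (e ℕ.* p))             ≡⟨ regroup e r i p ⟩
  e ℕ.+ i ℕ.* r ℕ.* (e ℕ.* p)               ≡⟨ cong (λ w → e ℕ.+ w ℕ.* (e ℕ.* p)) eq ⟨
  e ℕ.+ (1 ℕ.+ j ℕ.* suc p) ℕ.* (e ℕ.* p)   ≡⟨ factor e j p ⟩
  (e ℕ.+ j ℕ.* (e ℕ.* p)) ℕ.* suc p         ∎)
  where
  open ≡-Reasoning
  regroup : ∀ e r i p → e ℕ.+ r ℕ.* (i ℕ.* (e ℕ.* p)) ≡ e ℕ.+ i ℕ.* r ℕ.* (e ℕ.* p)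
  regroup = ℕ.solve-∀
  factor : ∀ e j p → e ℕ.+ (1 ℕ.+ j ℕ.* (1 ℕ.+ p)) ℕ.* (e ℕ.* p) ≡ (e ℕ.+ j ℕ.* (e ℕ.* p)) ℕ.* (1 ℕ.+ p)
  factor = ℕ.solve-∀
... | Bézout.-+ i j eq = i ℕ.* e , ℕ.divides (j ℕ.* e) (begin
  e ℕ.+ r ℕ.* (i ℕ.* e)      ≡⟨ regroup e r i ⟩
  (1 ℕ.+ i ℕ.* r) ℕ.* e      ≡⟨ cong (ℕ._* e) eq ⟩
  j ℕ.* suc p ℕ.* e          ≡⟨ swap j (suc p) e ⟩
  j ℕ.* e ℕ.* suc p          ∎)
  where
  open ≡-Reasoning
  regroup : ∀ e r i → e ℕ.+ r ℕ.* (i ℕ.* e) ≡ (1 ℕ.+ i ℕ.* r) ℕ.* e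
  regroup = ℕ.solve-∀
  swap : ∀ j q e → j ℕ.* q ℕ.* e ≡ j ℕ.* e ℕ.* q
  swap = ℕ.solve-∀

-- Valuations of `a ^ d − 1` and lifting the exponent.

-- Binomial expansion to first order: every term from the quadratic one on is divisible by
-- `p * r * p`, and `t` collects the cofactors. In the uses `r` is a power of `p`, so that `p * r`
-- is the next power.
1+pr-^ : ∀ p r s k → ∃ λ t → (1 ℕ.+ p ℕ.* r ℕ.* s) ^ k ≡ 1 ℕ.+ p ℕ.* r ℕ.* (k ℕ.* s ℕ.+ p ℕ.* t)
1+pr-^ p r s zero    = 0 , base p r
  where
  base : ∀ p r → 1 ≡ 1 ℕ.+ p ℕ.* r ℕ.* (p ℕ.* 0)
  base = ℕ.solve-∀
1+pr-^ p r s (suc k) with t , eq ← 1+pr-^ p r s k =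
  t ℕ.+ r ℕ.* s ℕ.* (k ℕ.* s ℕ.+ p ℕ.* t) ,
  trans (cong ((1 ℕ.+ p ℕ.* r ℕ.* s) ℕ.*_) eq) (step p r s k t)
  where
  step : ∀ p r s k t →
    (1 ℕ.+ p ℕ.* r ℕ.* s) ℕ.* (1 ℕ.+ p ℕ.* r ℕ.* (k ℕ.* s ℕ.+ p ℕ.* t)) ≡
    1 ℕ.+ p ℕ.* r ℕ.* ((1 ℕ.+ k) ℕ.* s ℕ.+ p ℕ.* (t ℕ.+ r ℕ.* s ℕ.* (k ℕ.* s ℕ.+ p ℕ.* t)))
  step = ℕ.solve-∀

-- For p prime: the p-adic valuation of a ^ d − 1 is exactly k.
ExactLevel : (p a k d : ℕ) → Set
ExactLevel p a k d = ∃ λ s → Coprime s p × a ^ d ≡ 1 ℕ.+ p ^ k ℕ.* s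

-- The new cofactor is `q * s` plus a multiple of `p`, hence still coprime to `p`. The level is a
-- successor because the expansion needs a factor `p` to absorb the higher terms.
exactLevel-* : ∀ {p a k d q} → Coprime q p → ExactLevel p a (suc k) d → ExactLevel p a (suc k) (d ℕ.* q)
exactLevel-* {p} {a} {k} {d} {q} q⊥p (s , s⊥p , eq) with t , eq′ ← 1+pr-^ p (p ^ k) s q =
  q ℕ.* s ℕ.+ p ℕ.* t , coprime-+* (coprime-* q⊥p s⊥p) t ,
  trans (sym (ℕ.^-*-assoc a d q)) (trans (cong (_^ q) eq) eq′)

-- Taking `p`-th powers adds exactly one to the valuation, from level `k₀` on. Here `r` stands for
-- the power of `p` beyond `p ^ k₀`; keeping it a variable turns each instance into a polynomial
-- identity.
RaisesLevel : (p k₀ : ℕ) → Set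
RaisesLevel p k₀ = ∀ r s → ∃ λ z →
  (1 ℕ.+ p ^ k₀ ℕ.* r ℕ.* s) ^ p ≡ 1 ℕ.+ p ^ k₀ ℕ.* (p ℕ.* r) ℕ.* (s ℕ.+ p ℕ.* z)

raisesLevel-2 : RaisesLevel 2 3
raisesLevel-2 r s = 2 ℕ.* r ℕ.* s ℕ.* s , identity r s
  where
  identity : ∀ r s →
    (1 ℕ.+ 8 ℕ.* r ℕ.* s) ℕ.* ((1 ℕ.+ 8 ℕ.* r ℕ.* s) ℕ.* 1) ≡
    1 ℕ.+ 8 ℕ.* (2 ℕ.* r) ℕ.* (s ℕ.+ 2 ℕ.* (2 ℕ.* r ℕ.* s ℕ.* s))
  identity = ℕ.solve-∀

raisesLevel-3 : RaisesLevel 3 1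
raisesLevel-3 r s = r ℕ.* s ℕ.* s ℕ.+ r ℕ.* r ℕ.* s ℕ.* s ℕ.* s , identity r s
  where
  identity : ∀ r s →
    (1 ℕ.+ 3 ℕ.* r ℕ.* s) ℕ.* ((1 ℕ.+ 3 ℕ.* r ℕ.* s) ℕ.* ((1 ℕ.+ 3 ℕ.* r ℕ.* s) ℕ.* 1)) ≡
    1 ℕ.+ 3 ℕ.* (3 ℕ.* r) ℕ.* (s ℕ.+ 3 ℕ.* (r ℕ.* s ℕ.* s ℕ.+ r ℕ.* r ℕ.* s ℕ.* s ℕ.* s))
  identity = ℕ.solve-∀

exactLevel-lift : ∀ {p a k₀ d} → RaisesLevel p k₀ → ExactLevel p a k₀ d →
                  ∀ j → ExactLevel p a (k₀ ℕ.+ j) (d ℕ.* p ^ j)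
exactLevel-lift {p} {a} {k₀} {d} raise level zero =
  subst₂ (ExactLevel p a) (sym (ℕ.+-identityʳ k₀)) (sym (ℕ.*-identityʳ d)) level
exactLevel-lift {p} {a} {k₀} {d} raise level (suc j)
  with s , s⊥p , eq ← exactLevel-lift {a = a} {k₀ = k₀} {d = d} raise level j
  with z , eq′ ← raise (p ^ j) s
  = s ℕ.+ p ℕ.* z , coprime-+* s⊥p z , (begin
  a ^ (d ℕ.* (p ℕ.* p ^ j))                        ≡⟨ cong (a ^_) (regroup d p (p ^ j)) ⟩
  a ^ (d ℕ.* p ^ j ℕ.* p)                          ≡⟨ ℕ.^-*-assoc a (d ℕ.* p ^ j) p ⟨
  (a ^ (d ℕ.* p ^ j)) ^ p                          ≡⟨ cong (_^ p) eq ⟩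
  (1 ℕ.+ p ^ (k₀ ℕ.+ j) ℕ.* s) ^ p                 ≡⟨ cong (λ w → (1 ℕ.+ w ℕ.* s) ^ p) (ℕ.^-distribˡ-+-* p k₀ j) ⟩
  (1 ℕ.+ p ^ k₀ ℕ.* p ^ j ℕ.* s) ^ p               ≡⟨ eq′ ⟩
  1 ℕ.+ p ^ k₀ ℕ.* p ^ suc j ℕ.* (s ℕ.+ p ℕ.* z)   ≡⟨ cong (λ w → 1 ℕ.+ w ℕ.* (s ℕ.+ p ℕ.* z)) (ℕ.^-distribˡ-+-* p k₀ (suc j)) ⟨
  1 ℕ.+ p ^ (k₀ ℕ.+ suc j) ℕ.* (s ℕ.+ p ℕ.* z)     ∎)
  where
  open ≡-Reasoning
  regroup : ∀ d p r → d ℕ.* (p ℕ.* r) ≡ d ℕ.* r ℕ.* p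
  regroup = ℕ.solve-∀

-- Dividing factors `p` out of `O` must stop after at most `m` of them; `q` is the remaining part
-- prime to `p`.
∤⇒∣^*coprime : ∀ {p O} → Prime p → ∀ m → ¬ p ^ suc m ∣ O → ∃ λ q → Coprime q p × O ∣ p ^ m ℕ.* q
∤⇒∣^*coprime {p} {O} pr m ∤O with p ℕ.∣? O
... | no p∤O = O , O⊥p , ℕ.∣n⇒∣m*n (p ^ m) ℕ.∣-refl
  where
  O⊥p : Coprime O p
  O⊥p (d∣O , d∣p) with prime⇒irreducible pr d∣p
  ... | inj₁ d≡1  = d≡1
  ... | inj₂ refl = contradiction d∣O p∤O
∤⇒∣^*coprime {p} pr zero    ∤O | yes p∣O = contradiction (subst (_∣ _) (sym (ℕ.*-identityʳ p)) p∣O) ∤O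
∤⇒∣^*coprime {p} pr (suc m) ∤O | yes (ℕ.divides O′ refl)
  with q , q⊥p , O′∣ ← ∤⇒∣^*coprime {O = O′} pr m
    (λ ∣O′ → ∤O (subst (p ^ suc (suc m) ∣_) (ℕ.*-comm p O′) (ℕ.*-monoʳ-∣ p ∣O′)))
  = q , q⊥p , subst₂ _∣_ (ℕ.*-comm p O′) (sym (ℕ.*-assoc p (p ^ m) q)) (ℕ.*-monoʳ-∣ p O′∣)

-- Hensel-type correction of the exponent.

-- The equation encodes a ^ (n + y) ≡ a ^ y − (p+1) ^ (x+1) modulo (p+1) ^ (x+1+i) without subtraction.
hensel : ∀ {p a x O} y → Coprime a (suc p) →
         (∀ i → ∃ λ d → O ∣ d × ExactLevel (suc p) a (suc x ℕ.+ i) d) →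
         ∀ i → ∃₂ λ n e → O ∣ n × a ^ (n ℕ.+ y) ℕ.+ suc p ^ suc x ≡ a ^ y ℕ.+ suc p ^ (suc x ℕ.+ i) ℕ.* e
-- At precision `suc x` the correction term is itself zero, so the exponent is kept and `e = 1`
-- accounts for the term.
hensel {p₋} {a} {x} y a⊥p levels zero = 0 , 1 , ℕ._∣0 _ ,
  cong (a ^ y ℕ.+_) (trans (cong (suc p₋ ^_) (sym (ℕ.+-identityʳ (suc x)))) (sym (ℕ.*-identityʳ _)))
hensel {p₋} {a} {x} {O} y a⊥p levels (suc i)
  with n , e , O∣n , eq ← hensel {x = x} y a⊥p levels i
  with d , O∣d , s , s⊥p , level ← levels i
  -- Adding `d * k` to the exponent changes the power by `P * (A * s * k)` up to multiples of
  -- `p * P`. Since `A * s` is invertible modulo `p`, `k` can be chosen to cancel the current error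
  -- digit `e`.
  with k , ℕ.divides c e+rk≡cp ← solve-linear e (coprime-* (coprime-^ a⊥p (n ℕ.+ y)) s⊥p)
  with t , expansion ← 1+pr-^ (suc p₋) (suc p₋ ^ (x ℕ.+ i)) s k
  = d ℕ.* k ℕ.+ n , c ℕ.+ t ℕ.* A , ℕ.∣m∣n⇒∣m+n (ℕ.∣m⇒∣m*n k O∣d) O∣n , (begin
  a ^ (d ℕ.* k ℕ.+ n ℕ.+ y) ℕ.+ X                    ≡⟨ cong (λ w → a ^ w ℕ.+ X) (ℕ.+-assoc (d ℕ.* k) n y) ⟩
  a ^ (d ℕ.* k ℕ.+ (n ℕ.+ y)) ℕ.+ X                  ≡⟨ cong (ℕ._+ X) (ℕ.^-distribˡ-+-* a (d ℕ.* k) (n ℕ.+ y)) ⟩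
  a ^ (d ℕ.* k) ℕ.* A ℕ.+ X                          ≡⟨ cong (λ w → w ℕ.* A ℕ.+ X) a^dk ⟩
  (1 ℕ.+ P ℕ.* (k ℕ.* s ℕ.+ p ℕ.* t)) ℕ.* A ℕ.+ X    ≡⟨ expand P k s p t A X ⟩
  (A ℕ.+ X) ℕ.+ P ℕ.* ((k ℕ.* s ℕ.+ p ℕ.* t) ℕ.* A)  ≡⟨ cong (ℕ._+ P ℕ.* ((k ℕ.* s ℕ.+ p ℕ.* t) ℕ.* A)) eq ⟩
  (B ℕ.+ P ℕ.* e) ℕ.+ P ℕ.* ((k ℕ.* s ℕ.+ p ℕ.* t) ℕ.* A)     ≡⟨ collect B P e k s p t A ⟩
  B ℕ.+ P ℕ.* ((e ℕ.+ A ℕ.* s ℕ.* k) ℕ.+ p ℕ.* t ℕ.* A)       ≡⟨ cong (λ w → B ℕ.+ P ℕ.* (w ℕ.+ p ℕ.* t ℕ.* A)) e+rk≡cp ⟩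
  B ℕ.+ P ℕ.* (c ℕ.* p ℕ.+ p ℕ.* t ℕ.* A)            ≡⟨ factor B P c p t A ⟩
  B ℕ.+ p ℕ.* P ℕ.* (c ℕ.+ t ℕ.* A)                  ≡⟨ cong (λ w → B ℕ.+ p ^ w ℕ.* (c ℕ.+ t ℕ.* A)) (ℕ.+-suc (suc x) i) ⟨
  B ℕ.+ p ^ (suc x ℕ.+ suc i) ℕ.* (c ℕ.+ t ℕ.* A)    ∎)
  where
  open ≡-Reasoning
  p = suc p₋
  A = a ^ (n ℕ.+ y)
  B = a ^ y
  X = p ^ suc x
  P = p ^ (suc x ℕ.+ i)

  a^dk : a ^ (d ℕ.* k) ≡ 1 ℕ.+ P ℕ.* (k ℕ.* s ℕ.+ p ℕ.* t)
  a^dk = trans (sym (ℕ.^-*-assoc a d k)) (trans (cong (_^ k) level) expansion)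

  expand : ∀ P k s p t A X → (1 ℕ.+ P ℕ.* (k ℕ.* s ℕ.+ p ℕ.* t)) ℕ.* A ℕ.+ X ≡
                             (A ℕ.+ X) ℕ.+ P ℕ.* ((k ℕ.* s ℕ.+ p ℕ.* t) ℕ.* A)
  expand = ℕ.solve-∀
  collect : ∀ B P e k s p t A → (B ℕ.+ P ℕ.* e) ℕ.+ P ℕ.* ((k ℕ.* s ℕ.+ p ℕ.* t) ℕ.* A) ≡
                                B ℕ.+ P ℕ.* ((e ℕ.+ A ℕ.* s ℕ.* k) ℕ.+ p ℕ.* t ℕ.* A)
  collect = ℕ.solve-∀
  factor : ∀ B P c p t A → B ℕ.+ P ℕ.* (c ℕ.* p ℕ.+ p ℕ.* t ℕ.* A) ≡ B ℕ.+ p ℕ.* P ℕ.* (c ℕ.+ t ℕ.* A)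
  factor = ℕ.solve-∀

-- Periodicity, congruences and indeterminate powers.

^-periodic : ∀ {a m} k z → + (a ^ k) ≡ + 1 [mod m ] → ∀ j → + (a ^ (j ℕ.* k ℕ.+ z)) ≡ + (a ^ z) [mod m ]
^-periodic {a} {m} k z a^k≡1 zero    = ℤ.divides (+ 0) (ℤ.+-inverseʳ (+ (a ^ z)))
^-periodic {a} {m} k z a^k≡1 (suc j) = subst (+ m ℤ.∣_) difference
  (ℤ.∣m∣n⇒∣m+n (ℤ.∣m⇒∣m*n (+ (a ^ l)) a^k≡1) (^-periodic k z a^k≡1 j))
  where
  l = j ℕ.* k ℕ.+ z

  telescope : ∀ A B C → (A ℤ.- + 1) ℤ.* B + (B ℤ.- C) ≡ A ℤ.* B ℤ.- C
  telescope = ℤ.solve-∀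

  difference : (+ (a ^ k) ℤ.- + 1) ℤ.* + (a ^ l) + (+ (a ^ l) ℤ.- + (a ^ z)) ≡
               + (a ^ (suc j ℕ.* k ℕ.+ z)) ℤ.- + (a ^ z)
  difference = trans (telescope (+ (a ^ k)) (+ (a ^ l)) (+ (a ^ z))) (cong (ℤ._- + (a ^ z)) (begin
    + (a ^ k) ℤ.* + (a ^ l)       ≡⟨ ℤ.pos-* (a ^ k) (a ^ l) ⟨
    + (a ^ k ℕ.* a ^ l)           ≡⟨ cong +_ (ℕ.^-distribˡ-+-* a k l) ⟨
    + (a ^ (k ℕ.+ l))             ≡⟨ cong (λ w → + (a ^ w)) (ℕ.+-assoc k (j ℕ.* k) z) ⟨
    + (a ^ (suc j ℕ.* k ℕ.+ z))   ∎))
    where open ≡-Reasoning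

∣-+-trans : ∀ {m n k} → m ∣ n → + n ℤ.∣ k → + m ℤ.∣ k
∣-+-trans {m} m∣n = ℤ.∣-trans (ℤ.∣ᵤ⇒∣ {+ m} m∣n)

≡-mod-trans : ∀ {m} a b c → a ≡ b [mod m ] → b ≡ c [mod m ] → a ≡ c [mod m ]
≡-mod-trans {m} a b c a≡b b≡c = subst (+ m ℤ.∣_) (telescope a b c) (ℤ.∣m∣n⇒∣m+n a≡b b≡c)
  where
  telescope : ∀ a b c → (a ℤ.- b) + (b ℤ.- c) ≡ a ℤ.- c
  telescope = ℤ.solve-∀

+≡+*⇒≡-mod : ∀ {m} A X B e → A ℕ.+ X ≡ B ℕ.+ m ℕ.* e → + A ≡ + B ℤ.- + X [mod m ]
+≡+*⇒≡-mod {m} A X B e eq = ℤ.divides (+ e) (begin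
  + A ℤ.- (+ B ℤ.- + X)             ≡⟨ regroup (+ A) (+ B) (+ X) ⟩
  + A + + X ℤ.- + B                 ≡⟨ cong (λ w → w ℤ.- + B) A+X ⟩
  + B + + m ℤ.* + e ℤ.- + B         ≡⟨ cancel (+ B) (+ m) (+ e) ⟩
  + e ℤ.* + m                       ∎)
  where
  open ≡-Reasoning
  A+X : + A + + X ≡ + B + + m ℤ.* + e
  A+X = trans (sym (ℤ.pos-+ A X)) (trans (cong +_ eq)
       (trans (ℤ.pos-+ B (m ℕ.* e)) (cong (λ w → + B + w) (ℤ.pos-* m e))))
  regroup : ∀ A B X → A ℤ.- (B ℤ.- X) ≡ A + X ℤ.- B
  regroup = ℤ.solve-∀
  cancel : ∀ B m e → B + m ℤ.* e ℤ.- B ≡ e ℤ.* m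
  cancel = ℤ.solve-∀

^-monoʳ-∣ : ∀ a {i j} → i ≤ j → a ^ i ∣ a ^ j
^-monoʳ-∣ a {i} {j} i≤j with o , refl ← ℕ.m≤n⇒∃[o]m+o≡n i≤j =
  subst (a ^ i ∣_) (sym (ℕ.^-distribˡ-+-* a i o)) (ℕ.m∣m*n (a ^ o))

-- In `a ^ (P + i) − a ^ i = (a ^ P − 1) * a ^
-- i` the first factor is divisible by `N` and the second by `a ^ w`, so `P + i` is a second
-- exponent with the same residue.
periodic⇒indeterminate : ∀ {a N P w i} → 0 < P → + (a ^ P) ≡ + 1 [mod N ] → w ≤ i →
                         Indeterminate a i (N ℕ.* a ^ w)
periodic⇒indeterminate {a} {N} {P} {w} {i} 0<P a^P≡1 w≤i determinate =
  ℕ.<-irrefl (sym (determinate (P ℕ.+ i) congruent)) (ℕ.m<n+m i 0<P)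
  where
  factor : ∀ A B → (A ℤ.- + 1) ℤ.* B ≡ A ℤ.* B ℤ.- B
  factor = ℤ.solve-∀

  congruent : + (a ^ (P ℕ.+ i)) ≡ + (a ^ i) [mod N ℕ.* a ^ w ]
  congruent = subst₂ ℤ._∣_ (sym (ℤ.pos-* N (a ^ w)))
    (trans (factor (+ (a ^ P)) (+ (a ^ i)))
           (cong (ℤ._- + (a ^ i)) (trans (sym (ℤ.pos-* (a ^ P) (a ^ i)))
                                         (cong +_ (sym (ℕ.^-distribˡ-+-* a P i))))))
    (ℤ.∣-trans (ℤ.*-monoˡ-∣ (+ (a ^ w)) a^P≡1)
               (ℤ.*-monoʳ-∣ (+ (a ^ P) ℤ.- + 1) (ℤ.∣ᵤ⇒∣ {+ (a ^ w)} (^-monoʳ-∣ a w≤i))))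

-- `hensel` supplies `n + y`: its equation gives the congruence modulo `p ^ u`, and `O ∣ n` gives
-- the one modulo `M′`. Adding `w` times the order `P` of `a` modulo `p ^ u * M′` preserves both
-- and, as `P` is positive, pushes the exponent up to at least `w`.
adjust-exponent : ∀ {p a x O M′} .{{_ : NonZero a}} .{{_ : NonZero M′}} →
  Coprime a (suc p) → Coprime M′ a → + (a ^ O) ≡ + 1 [mod M′ ] →
  (∀ i → ∃ λ d → O ∣ d × ExactLevel (suc p) a (suc x ℕ.+ i) d) →
  ∀ u w y → ∃ λ y′ → w ≤ y′ ×
    (+ (a ^ y′) ≡ + (a ^ y) ℤ.- + (suc p ^ suc x) [mod suc p ^ u ]) ×
    (+ (a ^ y′) ≡ + (a ^ y) [mod M′ ]) ×
    Indeterminate a y′ (suc p ^ u ℕ.* M′ ℕ.* a ^ w)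
adjust-exponent {p₋} {a} {x} {O} {M′} {{a≢0}} a⊥p M′⊥a a^O≡1 levels u w y
  with n , e , ℕ.divides c n≡cO , eq ← hensel {x = x} y a⊥p levels u
  with P , isOrder ← order-exists a (suc p₋ ^ u ℕ.* M′) {{a≢0}}
         {{ℕ.m*n≢0 (suc p₋ ^ u) M′ {{ℕ.m^n≢0 (suc p₋) u}}}}
         (coprime-* (coprime-^ (Coprimality.sym a⊥p) u) M′⊥a)
  = w ℕ.* P ℕ.+ (n ℕ.+ y)
  , w≤
  , ≡-mod-trans (+ (a ^ (w ℕ.* P ℕ.+ (n ℕ.+ y)))) (+ (a ^ (n ℕ.+ y))) (+ (a ^ y) ℤ.- + (p ^ suc x))
      (∣-+-trans (ℕ.m∣m*n M′) shift)
      (∣-+-trans (^-monoʳ-∣ p (ℕ.m≤n+m u (suc x))) (+≡+*⇒≡-mod (a ^ (n ℕ.+ y)) (p ^ suc x) (a ^ y) e eq))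
  , ≡-mod-trans (+ (a ^ (w ℕ.* P ℕ.+ (n ℕ.+ y)))) (+ (a ^ (n ℕ.+ y))) (+ (a ^ y))
      (∣-+-trans (ℕ.n∣m*n (p ^ u)) shift)
      (subst (λ l → + (a ^ (l ℕ.+ y)) ≡ + (a ^ y) [mod M′ ]) (sym n≡cO) (^-periodic O y a^O≡1 c))
  , periodic⇒indeterminate positive power≡1 w≤
  where
  open IsOrder isOrder
  p = suc p₋

  w≤ : w ≤ w ℕ.* P ℕ.+ (n ℕ.+ y)
  w≤ = ℕ.≤-trans (ℕ.m≤m*n w P {{ℕ.>-nonZero positive}}) (ℕ.m≤m+n (w ℕ.* P) (n ℕ.+ y))

  shift : + (a ^ (w ℕ.* P ℕ.+ (n ℕ.+ y))) ≡ + (a ^ (n ℕ.+ y)) [mod p ^ u ℕ.* M′ ]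
  shift = ^-periodic P (n ℕ.+ y) power≡1 w

-- Exponents of prescribed level for the bases 3 and 2.

-- The start is `3 ^ 2 = 1 + 2 ^ 3`: the odd factor `q` keeps level 3, and each further factor 2
-- adds one. Level `3 + x + i` thus leaves `1 + x + i` factors 2 in `d`, enough for the at most
-- `x + 1` in `O`.
levels-of-3 : ∀ {O} x → ¬ 2 ^ suc (suc x) ∣ O → ∀ i → ∃ λ d → O ∣ d × ExactLevel 2 3 (3 ℕ.+ x ℕ.+ i) d
levels-of-3 {O} x ∤O i with q , q⊥2 , O∣ ← ∤⇒∣^*coprime (toWitness {a? = prime? 2} _) (suc x) ∤O =
  2 ℕ.* q ℕ.* 2 ^ (x ℕ.+ i)
  , ℕ.∣-trans O∣ (ℕ.divides (2 ^ i)
      (trans (cong (2 ℕ.* q ℕ.*_) (ℕ.^-distribˡ-+-* 2 x i)) (regroup q (2 ^ x) (2 ^ i))))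
  , exactLevel-lift {a = 3} {k₀ = 3} {d = 2 ℕ.* q} raisesLevel-2
      (exactLevel-* {a = 3} {k = 2} {d = 2} q⊥2 (1 , Coprimality.1-coprimeTo 2 , refl)) (x ℕ.+ i)
  where
  regroup : ∀ q X I → 2 ℕ.* q ℕ.* (X ℕ.* I) ≡ I ℕ.* (2 ℕ.* X ℕ.* q)
  regroup = ℕ.solve-∀

-- The start is `2 ^ 2 = 1 + 3`. Level `1 + y + i` leaves `y + i` factors 3 in `d`, enough for the
-- at most `y` in `O`.
levels-of-2 : ∀ {O} y → ¬ 3 ^ suc y ∣ O → ∀ i → ∃ λ d → O ∣ d × ExactLevel 3 2 (1 ℕ.+ y ℕ.+ i) d
levels-of-2 {O} y ∤O i with q , q⊥3 , O∣ ← ∤⇒∣^*coprime (toWitness {a? = prime? 3} _) y ∤O =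
  2 ℕ.* q ℕ.* 3 ^ (y ℕ.+ i)
  , ℕ.∣-trans O∣ (ℕ.divides (2 ℕ.* 3 ^ i)
      (trans (cong (2 ℕ.* q ℕ.*_) (ℕ.^-distribˡ-+-* 3 y i)) (regroup q (3 ^ y) (3 ^ i))))
  , exactLevel-lift {a = 2} {k₀ = 1} {d = 2 ℕ.* q} raisesLevel-3
      (exactLevel-* {a = 2} {k = 0} {d = 2} q⊥3 (1 , Coprimality.1-coprimeTo 3 , refl)) (y ℕ.+ i)
  where
  regroup : ∀ q Y I → 2 ℕ.* q ℕ.* (Y ℕ.* I) ≡ 2 ℕ.* I ℕ.* (Y ℕ.* q)
  regroup = ℕ.solve-∀

-- Combining the moduli.

-- It suffices that `D`, the change of `A − B` against the given solution, vanishes modulo the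
-- pairwise coprime `U`, `V` and `M′`. Modulo `U` the change of `A` is `−B₀`, which is also that of
-- `B`; modulo `V` both changes are `−A₀`.
difference-by-parts : ∀ {U V M′} (A B A₀ B₀ c : ℤ) → Coprime (U ℕ.* V) M′ → Coprime U V →
  A₀ ≡ c + B₀ [mod U ℕ.* V ℕ.* M′ ] →
  A ≡ A₀ ℤ.- B₀ [mod U ] → + U ℤ.∣ B →
  B ≡ B₀ ℤ.- A₀ [mod V ] → + V ℤ.∣ A →
  A ≡ A₀ [mod M′ ] → B ≡ B₀ [mod M′ ] →
  A ≡ c + B [mod U ℕ.* V ℕ.* M′ ]
difference-by-parts {U} {V} {M′} A B A₀ B₀ c UV⊥M′ U⊥V A₀≡ A≡U U∣B B≡V V∣A A≡M′ B≡M′ =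
  subst (+ (U ℕ.* V ℕ.* M′) ℤ.∣_) (combine A B A₀ B₀ c) (ℤ.∣m∣n⇒∣m+n A₀≡ all)
  where
  D = (A ℤ.- A₀) ℤ.- (B ℤ.- B₀)

  combine : ∀ A B A₀ B₀ c → (A₀ ℤ.- (c + B₀)) + ((A ℤ.- A₀) ℤ.- (B ℤ.- B₀)) ≡ A ℤ.- (c + B)
  combine = ℤ.solve-∀
  split-U : ∀ A B A₀ B₀ → (A ℤ.- (A₀ ℤ.- B₀)) ℤ.- B ≡ (A ℤ.- A₀) ℤ.- (B ℤ.- B₀)
  split-U = ℤ.solve-∀
  split-V : ∀ A B A₀ B₀ → A ℤ.- (B ℤ.- (B₀ ℤ.- A₀)) ≡ (A ℤ.- A₀) ℤ.- (B ℤ.- B₀)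
  split-V = ℤ.solve-∀

  all : + (U ℕ.* V ℕ.* M′) ℤ.∣ D
  all = ℤ.∣ᵤ⇒∣ (coprime-*-∣ UV⊥M′
    (coprime-*-∣ U⊥V
      (ℤ.∣⇒∣ᵤ (subst (+ U ℤ.∣_) (split-U A B A₀ B₀) (ℤ.∣m∣n⇒∣m-n A≡U U∣B)))
      (ℤ.∣⇒∣ᵤ (subst (+ V ℤ.∣_) (split-V A B A₀ B₀) (ℤ.∣m∣n⇒∣m-n V∣A B≡V))))
    (ℤ.∣⇒∣ᵤ (ℤ.∣m∣n⇒∣m-n A≡M′ B≡M′)))

lemma3p1 : (M : ℕ) .{{_ : NonZero M}} (x y : ℕ) (c : ℤ) → 2 < x → 0 < y →
    + (3 ^ y) ≡ c + + (2 ^ x) [mod M ] →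
    ¬ (2 ^ (x ∸ 1) ∣ O₃′ M) →
    ¬ (3 ^ y ∣ O₂′ M) →
    ∃₂ λ (x′ y′ : ℕ) →
    (+ (3 ^ y′) ≡ c + + (2 ^ x′) [mod M ]) ×
    Indeterminate 2 x′ M ×
    Indeterminate 3 y′ M
lemma3p1 M (suc (suc (suc x))) (suc y) c (s≤s (s≤s (s≤s _))) (s≤s _) 3^y≡c+2^x ∤O₃ ∤O₂ =
  let
    y′ , v≤y′ , 3^y′≡[2^u] , 3^y′≡[M′] , indet-3 =
      -- The original exponent of 2 is `suc (suc (suc x))`; the parameter passed is its predecessor,
      -- as the correction term is a power with exponent `suc` of it. The exponent of 3 is corrected
      -- to precision `u` at the prime 2 and made at least `v`; for the exponent of 2 the roles are
      -- exchanged.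
      adjust-exponent {x = suc (suc x)} {{_}} {{M′≢0}} 3⊥2 coprime-3
        (IsOrder.power≡1 (order-isOrder 3 M′ {{_}} {{M′≢0}} coprime-3))
        (levels-of-3 x ∤O₃) u v (suc y)
    x′ , u≤x′ , 2^x′≡[3^v] , 2^x′≡[M′] , indet-2 =
      adjust-exponent {x = y} {{_}} {{M′≢0}} (Coprimality.sym 3⊥2) coprime-2
        (IsOrder.power≡1 (order-isOrder 2 M′ {{_}} {{M′≢0}} coprime-2))
        (levels-of-2 y ∤O₂) v u (suc (suc (suc x)))
  in x′ , y′
   , subst (+ (3 ^ y′) ≡ c + + (2 ^ x′) [mod_]) (sym M≡)
       (difference-by-parts (+ (3 ^ y′)) (+ (2 ^ x′)) (+ (3 ^ suc y))
         (+ (2 ^ suc (suc (suc x)))) c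
         (coprime-* (coprime-^ (Coprimality.sym coprime-2) u) (coprime-^ (Coprimality.sym coprime-3) v))
         (Coprimality.sym (coprime-^ (Coprimality.sym (coprime-^ (Coprimality.sym 3⊥2) u)) v))
         (subst (+ (3 ^ suc y) ≡ c + + (2 ^ suc (suc (suc x))) [mod_]) M≡ 3^y≡c+2^x)
         3^y′≡[2^u] (ℤ.∣ᵤ⇒∣ (^-monoʳ-∣ 2 u≤x′))
         2^x′≡[3^v] (ℤ.∣ᵤ⇒∣ (^-monoʳ-∣ 3 v≤y′))
         3^y′≡[M′] 2^x′≡[M′])
   , subst (Indeterminate 2 x′) (trans (swap-2 (2 ^ u) (3 ^ v) M′) (sym M≡)) indet-2
   , subst (Indeterminate 3 y′) (trans (swap-3 (2 ^ u) (3 ^ v) M′) (sym M≡)) indet-3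
  where
  open Decomposition (decompose M)

  3⊥2 : Coprime 3 2
  3⊥2 = toWitness {a? = coprime? 3 2} _

  swap-2 : ∀ U V m → V ℕ.* m ℕ.* U ≡ U ℕ.* V ℕ.* m
  swap-2 = ℕ.solve-∀
  swap-3 : ∀ U V m → U ℕ.* m ℕ.* V ≡ U ℕ.* V ℕ.* m
  swap-3 = ℕ.solve-∀
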